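{- Let $\mathfrak X$ be a topological space. Then the formula $DS$, i.e. $[\neq]p\to\Diamond p$ (with $p$ a propositional letter), is valid in $\mathfrak X$ if and only if $\mathfrak X$ is dense-in-itself.
   Context: Formulas are built by $\phi ::= p \mid \bot \mid \phi\to\phi \mid \Box\phi \mid [\neq]\phi$, with $p$ ranging over propositional letters; $\neg$ is defined as usual and $\Diamond A=\neg\Box\neg A$. A valuation $\theta$ on a topological space $\mathfrak X$ assigns to each propositional letter a subset of $\mathfrak X$. Truth at a point is defined by: $\mathfrak X,\theta,x\models p$ iff $x\in\theta(p)$; $\bot$ is never true; $\to$ is interpreted classically; $\mathfrak X,\theta,x\models\Box\phi$ iff there is a neighborhood $U$ of $x$ with $\mathfrak X,\theta,y\models\phi$ for all $y\in U$; $\mathfrak X,\theta,x\models[\neq]\phi$ iff $\mathfrak X,\theta,y\models\phi$ for all $y\neq x$. A formula is valid in $\mathfrak X$ if it is true at every point under every valuation. A point $x$ is isolated if $\{x\}$ is open; $\mathfrak X$ is dense-in-itself if it has no isolated points. -}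

module Defs where

open import Data.Empty.Polymorphic using (⊥)
open import Data.Nat.Base using (ℕ)
open import Data.Product.Base using (_×_; ∃-syntax)
open import Level using (Level; Lift; suc)
open import Relation.Binary.PropositionalEquality.Core using (_≢_)
open import Relation.Nullary.Negation.Core using (¬_)
open import Relation.Unary using (Pred; _∈_; _⊆_; _≐_; _∩_; ⋃; ｛_｝)
open import Relation.Unary.Polymorphic using (∅; U)

-- Subsets are predicates, so openness has to be invariant under having the
-- same elements (`open-resp-≐`).  `IsOpen` may take values in the larger
-- universe `suc ℓ`, so that topologies defined by quantifying over subsets
-- are allowed.
record TopologicalSpace (ℓ : Level) : Set (suc (suc ℓ)) where
  field
    Point       : Set ℓ
    IsOpen      : Pred (Pred Point ℓ) (suc ℓ)
    open-resp-≐ : ∀ {A B} → A ≐ B → IsOpen A → IsOpen B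
    open-∅      : IsOpen ∅
    open-U      : IsOpen U
    open-∩      : ∀ {A B} → IsOpen A → IsOpen B → IsOpen (A ∩ B)
    open-⋃      : ∀ {I : Set ℓ} {F : I → Pred Point ℓ} →
                  (∀ i → IsOpen (F i)) → IsOpen (⋃ I F)

  -- Neighbourhoods need not be open.
  IsNeighbourhood : Pred Point ℓ → Point → Set (suc ℓ)
  IsNeighbourhood N x = ∃[ V ] IsOpen V × x ∈ V × V ⊆ N

  Isolated : Point → Set (suc ℓ)
  Isolated x = IsOpen ｛ x ｝

  DenseInItself : Set (suc ℓ)
  DenseInItself = ∀ x → ¬ Isolated x

Letter : Set
Letter = ℕ

infixr 5 _⇒_
infix  8 ~_ □_ ◇_ [≠]_

data Formula : Set where
  var  : Letter → Formula
  bot  : Formula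
  _⇒_  : Formula → Formula → Formula
  □_   : Formula → Formula
  [≠]_ : Formula → Formula

~_ : Formula → Formula
~ φ = φ ⇒ bot

◇_ : Formula → Formula
◇ φ = ~ □ ~ φ

DS : Letter → Formula
DS p = [≠] var p ⇒ ◇ var p

module _ {ℓ} (𝔛 : TopologicalSpace ℓ) where
  open TopologicalSpace 𝔛

  Valuation : Set (suc ℓ)
  Valuation = Letter → Pred Point ℓ

  -- Truth lives in `Set (suc ℓ)` because the clause for □ quantifies over
  -- subsets.  Implication is the function space of the metatheory, so it is
  -- classical implication under excluded middle at level `suc ℓ`.
  Truth : Valuation → Point → Formula → Set (suc ℓ)
  Truth θ x (var p)  = Lift (suc ℓ) (x ∈ θ p)
  Truth θ x bot      = ⊥
  Truth θ x (φ ⇒ ψ)  = Truth θ x φ → Truth θ x ψ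
  Truth θ x (□ φ)    = ∃[ N ] IsNeighbourhood N x × (∀ y → y ∈ N → Truth θ y φ)
  Truth θ x ([≠] φ)  = ∀ y → y ≢ x → Truth θ y φ

  Valid : Formula → Set (suc ℓ)
  Valid φ = ∀ (θ : Valuation) (x : Point) → Truth θ x φ

{-# OPTIONS --safe #-}
module Submission where

open import Defs
open import Level using (suc; Lift; lift; lower)
open import Axiom.ExcludedMiddle using (ExcludedMiddle)
open import Data.Product.Base using (_,_)
open import Function.Base using (id; _∘_)
open import Function.Bundles using (_⇔_; mk⇔)
open import Relation.Binary.PropositionalEquality.Core using (_≡_; _≢_; refl; sym; subst)
open import Relation.Nullary.Decidable.Core using (yes; no)
open import Relation.Nullary.Negation.Core using (contradiction)
open import Relation.Unary using (_⊆_; ｛_｝)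

-- `DS p` fails at `x` iff `p` holds at every other point while some neighbourhood of `x` misses
-- `p`. Such a neighbourhood contains no point but `x`, so a counterexample at `x` exists exactly
-- when `x` is isolated.

module _ {ℓ} (𝔛 : TopologicalSpace ℓ) (p : Letter) where
  open TopologicalSpace 𝔛

  -- At an isolated x, DS fails when p holds exactly at the points other than x.
  valid⇒dense : Valid 𝔛 (DS p) → DenseInItself
  valid⇒dense valid x isolated = lower (valid θ x (λ _ → lift) □~p)
    where
    θ : Valuation 𝔛
    θ _ y = y ≢ x

    □~p : Truth 𝔛 θ x (□ ~ var p)
    □~p = ｛ x ｝ , (｛ x ｝ , isolated , refl , id) ,
          λ y x≡y y≢x → contradiction (sym x≡y) (lower y≢x)

  module _ (em : ExcludedMiddle (suc ℓ)) where

    -- If p holds everywhere except possibly at x, an open V ∋ x on which p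
    -- fails can only be {x}.
    dense⇒valid : DenseInItself → Valid 𝔛 (DS p)
    dense⇒valid dense θ x [≠]p (N , (V , openV , x∈V , V⊆N) , ~p) =
      contradiction (open-resp-≐ (V⊆｛x｝ , λ x≡y → subst V x≡y x∈V) openV) (dense x)
      where
      V⊆｛x｝ : V ⊆ ｛ x ｝
      -- Refuting `x ≢ y` is the constructive part; `em` turns this into `x ≡ y`, lifted to the
      -- level of `em`.
      V⊆｛x｝ {y} y∈V with em {Lift (suc ℓ) (x ≡ y)}
      ... | yes x≡y = lower x≡y
      ... | no  x≢y = contradiction ([≠]p y (x≢y ∘ lift ∘ sym)) (lower ∘ ~p y (V⊆N y∈V))

lemma3p7 : ∀ {ℓ} → ExcludedMiddle (suc ℓ) → (𝔛 : TopologicalSpace ℓ) (p : Letter) → Valid 𝔛 (DS p) ⇔ TopologicalSpace.DenseInItself 𝔛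
lemma3p7 em 𝔛 p = mk⇔ (valid⇒dense 𝔛 p) (dense⇒valid 𝔛 p em)
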